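{- If $H$ is a graded digraph on $n$ vertices with maximum degree $\Delta\ge 1$ and height $h$, then $$\overrightarrow{r_1}(H)\le h^{10\Delta\log\Delta}\,n.$$ In particular, there is an absolute constant $C$ such that if $\Delta\ge 2$ then $\overrightarrow{r_1}(H)\le n^{C\Delta\log\Delta}$.
   Context: All digraphs are finite, simple and oriented (no loops, parallel or anti-parallel edges). The maximum degree of $H$ is $\max_{v}(|N^+(v)|+|N^-(v)|)$. The height of an acyclic digraph is the number of vertices on a longest directed path. An acyclic digraph $H$ of height $h$ is graded if $V(H)$ can be partitioned into $h$ independent sets $S_1,\dots,S_h$ such that every edge of $H$ is directed from some $S_i$ to $S_{i+1}$. A copy of $H$ in $T$ is given by an injective map $V(H)\to V(T)$ sending edges of $H$ to edges of $T$ with orientations preserved. $\overrightarrow{r_1}(H)$ is the least $N$ such that every tournament on $N$ vertices contains a copy of $H$. All logarithms are to base $2$. -}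

module Defs where

open import Data.Bool using (Bool; T)
open import Data.Fin using (Fin; toℕ)
open import Data.Fin.Subset using (Subset; ∣_∣)
open import Data.List using (List; length; map; allFin)
open import Data.List.Extrema.Nat using (max)
open import Data.List.Relation.Unary.Linked using (Linked)
open import Data.List.Relation.Unary.Unique.Propositional using (Unique)
open import Data.Nat using (ℕ; suc; _+_; _*_; _^_; _≤_; NonZero)
open import Data.Product using (Σ-syntax; ∃-syntax; _×_)
open import Data.Sum using (_⊎_)
open import Data.Vec using (tabulate)
open import Function.Definitions using (Injective)
open import Level using (0ℓ)
open import Relation.Binary.Construct.Closure.Transitive using (TransClosure)
open import Relation.Binary.Core using (Rel)
open import Relation.Binary.Definitions using (Asymmetric; Irreflexive)
open import Relation.Binary.PropositionalEquality using (_≡_; _≢_)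
open import Relation.Nullary using (¬_)

-- Oriented graphs on the vertex set Fin n.  Asymmetry rules out loops as well
-- as anti-parallel edges; a Boolean adjacency function has no parallel edges.
record Digraph (n : ℕ) : Set where
  field
    adj : Fin n → Fin n → Bool

  infix 4 _⟶_
  _⟶_ : Rel (Fin n) 0ℓ
  u ⟶ v = T (adj u v)

  field
    asym : Asymmetric _⟶_

  N⁺ N⁻ : Fin n → Subset n
  N⁺ v = tabulate λ u → adj v u
  N⁻ v = tabulate λ u → adj u v

  degree : Fin n → ℕ
  degree v = ∣ N⁺ v ∣ + ∣ N⁻ v ∣

  -- The first argument of max is only its value on the empty list (n = 0).
  maxDegree : ℕ
  maxDegree = max 0 (map degree (allFin n))

  -- No closed directed walk of positive length; in particular no directed cycle,
  -- and conversely every such walk contains a directed cycle.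
  Acyclic : Set
  Acyclic = Irreflexive _≡_ (TransClosure _⟶_)

  IsPath : List (Fin n) → Set
  IsPath vs = Linked _⟶_ vs × Unique vs

  -- Height counts the vertices of a longest path, not its edges.
  HasHeight : ℕ → Set
  HasHeight h = (∃[ vs ] (IsPath vs × length vs ≡ h))
              × (∀ vs → IsPath vs → length vs ≤ h)

  -- The parts of the partition are the fibres of level.  They are nonempty
  -- automatically, since a path on h vertices meets all h levels.
  record IsGraded (h : ℕ) : Set where
    field
      acyclic     : Acyclic
      height      : HasHeight h
      level       : Fin n → Fin h
      independent : ∀ {u v} → level u ≡ level v → ¬ (u ⟶ v)
      consecutive : ∀ {u v} → u ⟶ v → toℕ (level v) ≡ suc (toℕ (level u))

record Tournament (N : ℕ) : Set where
  field
    digraph : Digraph N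
  open Digraph digraph public
  field
    total : ∀ {u v} → u ≢ v → u ⟶ v ⊎ v ⟶ u

Copy : ∀ {n N} → Digraph n → Tournament N → Set
Copy {n} {N} H T′ =
  Σ[ f ∈ (Fin n → Fin N) ]
    (Injective _≡_ _≡_ f × (∀ {u v} → u H.⟶ v → f u T′.⟶ f v))
  where
  module H = Digraph H
  module T′ = Tournament T′

Unavoidable : ∀ {n} → Digraph n → ℕ → Set
Unavoidable H N = (T′ : Tournament N) → Copy H T′

-- IsRamseyNumber H r says that r is the oriented Ramsey number r⃗₁(H).
record IsRamseyNumber {n} (H : Digraph n) (r : ℕ) : Set where
  field
    unavoidable : Unavoidable H r
    least       : ∀ {N} → Unavoidable H N → r ≤ N

-- A nonnegative real x, given by its rational upper bounds: the type x p q
-- (for q ≢ 0) is the proposition x ≤ p / q.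
UpperCut : Set₁
UpperCut = ℕ → ℕ → Set

-- k · log₂ d, for d ≥ 1:  k log₂ d ≤ p / q  iff  d ^ (k q) ≤ 2 ^ p.
infix 8 _·log₂_
_·log₂_ : ℕ → ℕ → UpperCut
(k ·log₂ d) p q = d ^ (k * q) ≤ 2 ^ p

-- The inequality r ≤ b ^ x * m with a real exponent x, for b ≥ 1.  By
-- continuity and monotonicity, b ^ x is the infimum of b ^ (p / q) over the
-- rationals p / q ≥ x, and r ≤ b ^ (p / q) * m iff r ^ q ≤ b ^ p * m ^ q.
infix 4 _≤[_^^_]*_
_≤[_^^_]*_ : ℕ → ℕ → UpperCut → ℕ → Set
r ≤[ b ^^ x ]* m = ∀ p q → .{{NonZero q}} → x p q → r ^ q ≤ b ^ p * m ^ q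

{-# OPTIONS --safe #-}

-- With q = 8Δ, a tournament on a set X of at least 4 n q^Δ vertices either contains
-- H, or contains sets A, B of sizes at least |X| / q^Δ and 2|X| / q^Δ such that
-- every vertex of A sends edges to all but a 1/(4Δ) fraction of B: H is embedded greedily, each
-- unplaced vertex keeping a candidate set that shrinks by a factor at most q per
-- placed out-neighbour, and a step can only be blocked by such a pair.  Hence a
-- tournament without H contains a chain of 2^j sets in which every vertex of a set
-- receives edges from all but a 1/(2Δ) fraction of the preceding set: build a chain
-- of 2^(j-1) sets in A, restrict B to the vertices that receive enough edges from
-- the last set of this chain, which is at least half of B, and build the second
-- half of the chain there.  Choosing the halves one after the other is what keeps
-- the loss per doubling at q^Δ.  A chain of at least h sets contains H, one level
-- per set.  For Δ = 1 the digraph is a matching, and any n vertices suffice.  The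
-- least N exists constructively because unavoidability is decidable.
module Submission where

open import Data.Bool using (Bool; true; false; T; not; _∧_; if_then_else_)
open import Data.Bool.Properties using (T-∧; T?)
open import Data.Fin using (Fin; toℕ; zero; suc; combine; remQuot; finToFun; funToFin; opposite)
import Data.Fin as Fin
import Data.Fin.Properties as Fin
open import Data.Fin.Subset using (Subset; ∣_∣)
open import Data.Fin.Subset.Properties using (anySubset?)
open import Data.List as List using (List; map; allFin)
open import Data.List.Extrema.Nat using (xs≤max; max≤v⁺)
open import Data.List.Membership.Propositional.Properties using (∈-map⁺; ∈-allFin; ∈-lookup)
import Data.List.Relation.Unary.All as All
import Data.List.Relation.Unary.All.Properties as All
open import Data.List.Relation.Unary.AllPairs using (_∷_)
open import Data.List.Relation.Unary.Unique.Propositional using (Unique)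
open import Data.Nat
open import Data.Nat.Properties
open import Data.Nat.Tactic.RingSolver using (solve-∀)
open import Data.Product using (∃-syntax; _×_; _,_; proj₁; proj₂)
import Data.Sum as Sum
open import Data.Sum using (_⊎_; inj₁; inj₂; [_,_]′)
open import Data.Vec using (lookup; tabulate)
open import Data.Vec.Properties using (lookup∘tabulate)
open import Data.Vec.Functional using (updateAt)
open import Data.Vec.Functional.Properties using (updateAt-updates; updateAt-minimal)
open import Data.Unit using (tt)
open import Data.Empty using (⊥; ⊥-elim)
open import Function using (_∘_; id; Equivalence)
open import Relation.Nullary using (¬_; Dec; yes; no; does; contradiction; ¬?; _×-dec_; _⊎-dec_; _→-dec_)
open import Relation.Nullary.Decidable using (decidable-stable)
open import Relation.Binary.PropositionalEquality
open import Algebra.Properties.Semiring.Sum +-*-semiring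
  using (sum; sum-cong-≗; ∑-distrib-+; ∑-comm; *-distribˡ-sum; *-distribʳ-sum)

open import Defs
open Digraph using (maxDegree; IsGraded)

private variable
  k m n N : ℕ

-- Counting in finite sets given by Boolean predicates.

⟦_⟧ : Bool → ℕ
⟦ b ⟧ = if b then 1 else 0

∧⁻ : ∀ {a b} → T (a ∧ b) → T a × T b
∧⁻ = Equivalence.to T-∧

∧⁺ : ∀ {a b} → T a → T b → T (a ∧ b)
∧⁺ p q = Equivalence.from T-∧ (p , q)

⟦⟧-mono : ∀ {a b} → (T a → T b) → ⟦ a ⟧ ≤ ⟦ b ⟧
⟦⟧-mono {false} _ = z≤n
⟦⟧-mono {true} {true} _ = ≤-refl
⟦⟧-mono {true} {false} f = ⊥-elim (f tt)

T-ext : ∀ {a b} → (T a → T b) → (T b → T a) → a ≡ b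
T-ext {true}  {true}  _ _ = refl
T-ext {true}  {false} f _ = ⊥-elim (f tt)
T-ext {false} {true}  _ g = ⊥-elim (g tt)
T-ext {false} {false} _ _ = refl

Sub : ℕ → Set
Sub N = Fin N → Bool

infix 4 _⊆_
infix 9 #_

_⊆_ : Sub N → Sub N → Set
A ⊆ B = ∀ {i} → T (A i) → T (B i)

#_ : Sub N → ℕ
# S = sum (λ i → ⟦ S i ⟧)

infixl 7 _∩_ _∖_

_∩_ _∖_ : Sub N → Sub N → Sub N
(A ∩ B) i = A i ∧ B i
(A ∖ B) i = A i ∧ not (B i)

sum-mono : ∀ {f g : Fin n → ℕ} → (∀ i → f i ≤ g i) → sum f ≤ sum g
sum-mono {zero}  f≤g = z≤n
sum-mono {suc n} f≤g = +-mono-≤ (f≤g zero) (sum-mono (f≤g ∘ suc))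

sum-<⇒∃ : ∀ (f g : Fin n → ℕ) → sum f < sum g → ∃[ i ] f i < g i
sum-<⇒∃ f g f<g with Fin.any? (λ i → f i <? g i)
... | yes p = p
... | no ¬p = contradiction f<g (≤⇒≯ (sum-mono (λ i → ≮⇒≥ (λ lt → ¬p (i , lt)))))

#-mono : ∀ {A B : Sub N} → A ⊆ B → # A ≤ # B
#-mono A⊆B = sum-mono λ i → ⟦⟧-mono (A⊆B {i})

sum-const : ∀ n c → sum {n} (λ _ → c) ≡ n * c
sum-const zero    c = refl
sum-const (suc n) c = cong (c +_) (sum-const n c)

#-inhabited : (S : Sub N) → 0 < # S → ∃[ i ] T (S i)
#-inhabited {N} S 0<S with sum-<⇒∃ (λ _ → 0) (λ i → ⟦ S i ⟧) (subst (_< # S) (sym (trans (sum-const N 0) (*-zeroʳ N))) 0<S)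
... | i , lt with S i in eq
...   | true = i , subst T (sym eq) tt

#-split : (A B : Sub N) → # A ≡ # (A ∩ B) + # (A ∖ B)
#-split A B = trans (sum-cong-≗ λ i → lem (A i) (B i)) (∑-distrib-+ (λ i → ⟦ (A ∩ B) i ⟧) (λ i → ⟦ (A ∖ B) i ⟧))
  where
  lem : ∀ a b → ⟦ a ⟧ ≡ ⟦ a ∧ b ⟧ + ⟦ a ∧ not b ⟧
  lem true true = refl
  lem true false = refl
  lem false b = refl

sum-δ : (i : Fin n) → sum (λ j → ⟦ does (i Fin.≟ j) ⟧) ≡ 1
sum-δ {suc n} zero    = cong suc (trans (sum-const n 0) (*-zeroʳ n))
sum-δ {suc n} (suc i) = sum-δ i

sum-δ* : (f : Fin n → ℕ) (i : Fin n) → sum (λ j → ⟦ does (i Fin.≟ j) ⟧ * f j) ≡ f i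
sum-δ* f i = begin
  sum (λ j → ⟦ does (i Fin.≟ j) ⟧ * f j) ≡⟨ sum-cong-≗ (λ j → lem j) ⟩
  sum (λ j → ⟦ does (i Fin.≟ j) ⟧ * f i) ≡⟨ *-distribʳ-sum (f i) (λ j → ⟦ does (i Fin.≟ j) ⟧) ⟨
  sum (λ j → ⟦ does (i Fin.≟ j) ⟧) * f i ≡⟨ cong (_* f i) (sum-δ i) ⟩
  1 * f i                                ≡⟨ *-identityˡ (f i) ⟩
  f i                                    ∎
  where
  open ≡-Reasoning
  lem : ∀ j → ⟦ does (i Fin.≟ j) ⟧ * f j ≡ ⟦ does (i Fin.≟ j) ⟧ * f i
  lem j with i Fin.≟ j
  ... | yes refl = refl
  ... | no _     = refl

double-count : (A : Sub m) (B : Sub n) (r : Fin m → Fin n → Bool) →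
  sum (λ b → ⟦ B b ⟧ * # (λ a → A a ∧ r a b)) ≡ sum (λ a → ⟦ A a ⟧ * # (λ b → B b ∧ r a b))
double-count A B r = begin
  sum (λ b → ⟦ B b ⟧ * # (λ a → A a ∧ r a b))
    ≡⟨ sum-cong-≗ (λ b → *-distribˡ-sum ⟦ B b ⟧ (λ a → ⟦ A a ∧ r a b ⟧)) ⟩
  sum (λ b → sum (λ a → ⟦ B b ⟧ * ⟦ A a ∧ r a b ⟧))
    ≡⟨ ∑-comm (λ b a → ⟦ B b ⟧ * ⟦ A a ∧ r a b ⟧) ⟩
  sum (λ a → sum (λ b → ⟦ B b ⟧ * ⟦ A a ∧ r a b ⟧))
    ≡⟨ sum-cong-≗ (λ a → sum-cong-≗ λ b → swap (B b) (A a) (r a b)) ⟩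
  sum (λ a → sum (λ b → ⟦ A a ⟧ * ⟦ B b ∧ r a b ⟧))
    ≡⟨ sum-cong-≗ (λ a → *-distribˡ-sum ⟦ A a ⟧ (λ b → ⟦ B b ∧ r a b ⟧)) ⟨
  sum (λ a → ⟦ A a ⟧ * # (λ b → B b ∧ r a b)) ∎
  where
  open ≡-Reasoning
  swap : ∀ x y z → ⟦ x ⟧ * ⟦ y ∧ z ⟧ ≡ ⟦ y ⟧ * ⟦ x ∧ z ⟧
  swap true  true  z = refl
  swap true  false z = refl
  swap false true  z = refl
  swap false false z = refl

-- Count the pairs from `A` and `B` not related by `r`. There are at most `# A * # B / (2 * D)` of
-- them, while an exceptional `b` lies in more than `# A / D`. Hence at most half of `B` is
-- exceptional.
most-have-few-exceptions : (A : Sub m) (B : Sub n) (r : Fin m → Fin n → Bool) (D : ℕ) → 0 < # A →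
  (∀ a → T (A a) → 2 * D * # (B ∖ r a) ≤ # B) →
  # B ≤ 2 * # (λ b → B b ∧ (D * # (A ∖ (λ a → r a b)) ≤ᵇ # A))
most-have-few-exceptions A B r D 0<A hyp = begin
  # B                             ≡⟨ #-split B good ⟩
  # (B ∩ good) + # (B ∖ good)     ≤⟨ +-monoʳ-≤ (# (B ∩ good)) minority ⟩
  # (B ∩ good) + # (B ∩ good)     ≡⟨ cong (# (B ∩ good) +_) (+-identityʳ (# (B ∩ good))) ⟨
  2 * # (B ∩ good)                ∎
  where
  open ≤-Reasoning
  few : Fin _ → ℕ
  few b = # (A ∖ (λ a → r a b))
  good : Sub _
  good b = D * few b ≤ᵇ # A
  bad-many : ∀ b → ⟦ (B ∖ good) b ⟧ * # A ≤ D * (⟦ B b ⟧ * few b)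
  bad-many b with B b
  ... | false = z≤n
  ... | true with D * few b ≤ᵇ # A in eq
  ...   | true  = z≤n
  ...   | false = begin
    1 * # A           ≡⟨ *-identityˡ _ ⟩
    # A               ≤⟨ ≰⇒≥ (λ le → subst T eq (≤⇒≤ᵇ le)) ⟩
    D * few b         ≡⟨ cong (D *_) (sym (*-identityˡ (few b))) ⟩
    D * (1 * few b)   ∎
  good-few : ∀ a → 2 * D * (⟦ A a ⟧ * # (B ∖ r a)) ≤ ⟦ A a ⟧ * # B
  good-few a with A a in eq
  ... | false = ≤-reflexive (*-zeroʳ (2 * D))
  ... | true = begin
    2 * D * (1 * # (B ∖ r a)) ≡⟨ cong (2 * D *_) (*-identityˡ (# (B ∖ r a))) ⟩
    2 * D * # (B ∖ r a)       ≤⟨ hyp a (subst T (sym eq) tt) ⟩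
    # B                       ≡⟨ *-identityˡ _ ⟨
    1 * # B                   ∎
  few-bad : 2 * # (B ∖ good) ≤ # B
  few-bad = *-cancelʳ-≤ _ _ (# A) {{>-nonZero 0<A}} (begin
    2 * # (B ∖ good) * # A
      ≡⟨ *-assoc 2 (# (B ∖ good)) (# A) ⟩
    2 * (# (B ∖ good) * # A)
      ≡⟨ cong (2 *_) (*-distribʳ-sum (# A) (λ b → ⟦ (B ∖ good) b ⟧)) ⟩
    2 * sum (λ b → ⟦ (B ∖ good) b ⟧ * # A)
      ≤⟨ *-monoʳ-≤ 2 (sum-mono bad-many) ⟩
    2 * sum (λ b → D * (⟦ B b ⟧ * few b))
      ≡⟨ cong (2 *_) (sym (*-distribˡ-sum D (λ b → ⟦ B b ⟧ * few b))) ⟩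
    2 * (D * sum (λ b → ⟦ B b ⟧ * few b))
      ≡⟨ cong (λ x → 2 * (D * x)) (double-count A B (λ a b → not (r a b))) ⟩
    2 * (D * sum (λ a → ⟦ A a ⟧ * # (B ∖ r a)))
      ≡⟨ sym (*-assoc 2 D _) ⟩
    2 * D * sum (λ a → ⟦ A a ⟧ * # (B ∖ r a))
      ≡⟨ *-distribˡ-sum (2 * D) (λ a → ⟦ A a ⟧ * # (B ∖ r a)) ⟩
    sum (λ a → 2 * D * (⟦ A a ⟧ * # (B ∖ r a)))
      ≤⟨ sum-mono good-few ⟩
    sum (λ a → ⟦ A a ⟧ * # B)
      ≡⟨ sym (*-distribʳ-sum (# B) (λ a → ⟦ A a ⟧)) ⟩
    # A * # B
      ≡⟨ *-comm (# A) (# B) ⟩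
    # B * # A ∎)
  minority : # (B ∖ good) ≤ # (B ∩ good)
  minority = +-cancelʳ-≤ (# (B ∖ good)) _ _ (begin
    # (B ∖ good) + # (B ∖ good)  ≡⟨ cong (# (B ∖ good) +_) (+-identityʳ (# (B ∖ good))) ⟨
    2 * # (B ∖ good)             ≤⟨ few-bad ⟩
    # B                          ≡⟨ #-split B good ⟩
    # (B ∩ good) + # (B ∖ good)  ∎)

-- Greedy embedding with candidate sets.

-- Vertices are placed in the order of their keys; the key decreases along
-- edges, so all out-neighbours of a vertex are placed before it.  S u is the set
-- of candidates for the image of u, and d u counts the placed out-neighbours.
module Greedy {n N K} (H : Digraph n) (T′ : Tournament N)
  (key : Fin n → Fin K) (key-injective : ∀ {u v} → key u ≡ key v → u ≡ v)
  (key-decreasing : ∀ {u v} → Digraph._⟶_ H u v → key v Fin.< key u)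
  (Good : Fin n → ℕ → Sub N → Set) (Exit : Set)
  (choose : (f : Fin n → Fin N) (S : Fin n → Sub N) (d : Fin n → ℕ) (v : Fin n) →
    (∀ u → Good u (d u) (S u)) → d v ≡ # Digraph.adj H v →
    (∀ {u} → Digraph._⟶_ H u v → d u < # Digraph.adj H u) →
    Exit ⊎ ∃[ w ] (T (S v w) × (∀ x → f x ≢ w) ×
      (∀ {u} → Digraph._⟶_ H u v → Good u (suc (d u)) (S u ∩ λ x → Tournament.adj T′ x w))))
  where
  private
    module H = Digraph H
    module T′ = Tournament T′

  placed-outdegree : ℕ → Fin n → ℕ
  placed-outdegree s u = # (λ x → H.adj u x ∧ (toℕ (key x) <ᵇ s))

  -- The vertices with key below `s` are placed; the values of `f` elsewhere are junk. `edges` can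
  -- ask for the tail alone to be placed, as the head has a smaller key. `compatible` makes any
  -- later choice from `S u` respect the edges leaving `u`.
  record Stage (s : ℕ) : Set where
    field
      f          : Fin n → Fin N
      S          : Fin n → Sub N
      good       : ∀ u → Good u (placed-outdegree s u) (S u)
      compatible : ∀ {u v w} → u H.⟶ v → toℕ (key v) < s → T (S u w) → w T′.⟶ f v
      edges      : ∀ {u v} → u H.⟶ v → toℕ (key u) < s → f u T′.⟶ f v
      injective  : ∀ {u v} → toℕ (key u) < s → toℕ (key v) < s → f u ≡ f v → u ≡ v

  module _ {v : Fin n} where
    s : ℕ
    s = toℕ (key v)

    <suc-elim : ∀ {x} → toℕ (key x) < suc s → x ≢ v → toℕ (key x) < s
    <suc-elim lt x≢v = ≤∧≢⇒< (≤-pred lt) (x≢v ∘ key-injective ∘ Fin.toℕ-injective)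

    placed-outdegree-suc : ∀ u → placed-outdegree (suc s) u ≡ placed-outdegree s u + ⟦ H.adj u v ⟧
    placed-outdegree-suc u = begin
      placed-outdegree (suc s) u
        ≡⟨ sum-cong-≗ pointwise ⟩
      sum (λ x → ⟦ H.adj u x ∧ (toℕ (key x) <ᵇ s) ⟧ + ⟦ does (v Fin.≟ x) ⟧ * ⟦ H.adj u x ⟧)
        ≡⟨ ∑-distrib-+ (λ x → ⟦ H.adj u x ∧ (toℕ (key x) <ᵇ s) ⟧) (λ x → ⟦ does (v Fin.≟ x) ⟧ * ⟦ H.adj u x ⟧) ⟩
      placed-outdegree s u + sum (λ x → ⟦ does (v Fin.≟ x) ⟧ * ⟦ H.adj u x ⟧)
        ≡⟨ cong (placed-outdegree s u +_) (sum-δ* (λ x → ⟦ H.adj u x ⟧) v) ⟩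
      placed-outdegree s u + ⟦ H.adj u v ⟧ ∎
      where
      open ≡-Reasoning
      pointwise : ∀ x → ⟦ H.adj u x ∧ (toℕ (key x) <ᵇ suc s) ⟧
                      ≡ ⟦ H.adj u x ∧ (toℕ (key x) <ᵇ s) ⟧ + ⟦ does (v Fin.≟ x) ⟧ * ⟦ H.adj u x ⟧
      pointwise x with H.adj u x
      ... | false = sym (*-zeroʳ ⟦ does (v Fin.≟ x) ⟧)
      ... | true with v Fin.≟ x
      ...   | yes refl
        rewrite T-ext {s <ᵇ suc s} {true} _ (λ _ → <⇒<ᵇ (n<1+n s))
              | T-ext {s <ᵇ s} {false} (λ t → n≮n s (<ᵇ⇒< s s t)) (λ ()) = refl
      ...   | no v≢x
        rewrite T-ext {toℕ (key x) <ᵇ suc s} {toℕ (key x) <ᵇ s}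
                  (λ t → <⇒<ᵇ (<suc-elim (<ᵇ⇒< _ _ t) (v≢x ∘ sym)))
                  (λ t → <⇒<ᵇ (m<n⇒m<1+n (<ᵇ⇒< (toℕ (key x)) s t))) = sym (+-identityʳ _)

    placed-outdegree-edge : ∀ {u} → u H.⟶ v → placed-outdegree (suc s) u ≡ suc (placed-outdegree s u)
    placed-outdegree-edge {u} uv = trans (placed-outdegree-suc u)
      (trans (cong (λ b → placed-outdegree s u + ⟦ b ⟧) (T-ext {H.adj u v} {true} _ (λ _ → uv))) (+-comm _ 1))

    placed-outdegree-nonedge : ∀ {u} → ¬ u H.⟶ v → placed-outdegree (suc s) u ≡ placed-outdegree s u
    placed-outdegree-nonedge {u} ¬uv = trans (placed-outdegree-suc u)
      (trans (cong (λ b → placed-outdegree s u + ⟦ b ⟧) (T-ext {H.adj u v} {false} ¬uv λ ())) (+-identityʳ _))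

    placed-outdegree-self : placed-outdegree s v ≡ # H.adj v
    placed-outdegree-self = sum-cong-≗ λ x → cong ⟦_⟧
      (T-ext {H.adj v x ∧ _} (proj₁ ∘ ∧⁻) (λ e → ∧⁺ e (<⇒<ᵇ (key-decreasing e))))

  placed-outdegree≤ : ∀ s u → placed-outdegree s u ≤ # H.adj u
  placed-outdegree≤ s u = #-mono {A = λ x → H.adj u x ∧ _} {H.adj u} (proj₁ ∘ ∧⁻)

  -- `key` need not be onto `Fin K`, so some stages have no vertex to place.
  skip : ∀ {s} → (∀ x → toℕ (key x) ≢ s) → Stage s → Stage (suc s)
  skip {s} none st = record
    { f = f ; S = S
    ; good = λ u → subst (λ d → Good u d (S u)) (sum-cong-≗ (λ x → cong (λ b → ⟦ H.adj u x ∧ b ⟧) (same x))) (good u)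
    ; compatible = λ e lt → compatible e (back lt)
    ; edges = λ e lt → edges e (back lt)
    ; injective = λ lt lt′ → injective (back lt) (back lt′)
    }
    where
    open Stage st
    back : ∀ {x} → toℕ (key x) < suc s → toℕ (key x) < s
    back lt = ≤∧≢⇒< (≤-pred lt) (none _)
    same : ∀ x → (toℕ (key x) <ᵇ s) ≡ (toℕ (key x) <ᵇ suc s)
    same x = T-ext (λ t → <⇒<ᵇ (m<n⇒m<1+n (<ᵇ⇒< (toℕ (key x)) s t))) (λ t → <⇒<ᵇ (back (<ᵇ⇒< _ _ t)))

  place : ∀ v → Stage (toℕ (key v)) → Exit ⊎ Stage (suc (toℕ (key v)))
  place v st with choose (Stage.f st) (Stage.S st) (placed-outdegree s) v (Stage.good st) placed-outdegree-self
                    -- `v` is an out-neighbour of `u` that is still unplaced, which makes the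
                    -- inequality strict.
                    (λ {u} e → subst (_≤ # H.adj u) (placed-outdegree-edge e) (placed-outdegree≤ (suc s) u))
  ... | inj₁ exit = inj₁ exit
  ... | inj₂ (w , Svw , fresh , goodw) = inj₂ record
    { f = f′ ; S = S′ ; good = good′ ; compatible = compatible′ ; edges = edges′ ; injective = injective′ }
    where
    open Stage st
    f′ : Fin n → Fin N
    f′ = updateAt f v (λ _ → w)
    new : f′ v ≡ w
    new = updateAt-updates v f
    old : ∀ {x} → x ≢ v → f′ x ≡ f x
    old {x} x≢v = updateAt-minimal x v f x≢v
    S′ : Fin n → Sub N
    S′ u = if H.adj u v then S u ∩ (λ x → T′.adj x w) else S u
    S′-edge : ∀ {u} → u H.⟶ v → S′ u ≡ S u ∩ (λ x → T′.adj x w)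
    S′-edge {u} e with H.adj u v
    ... | true = refl
    S′-nonedge : ∀ {u} → ¬ u H.⟶ v → S′ u ≡ S u
    S′-nonedge {u} ¬e with H.adj u v
    ... | true = ⊥-elim (¬e tt)
    ... | false = refl
    S′⊆S : ∀ u → S′ u ⊆ S u
    S′⊆S u with H.adj u v
    ... | true = proj₁ ∘ ∧⁻
    ... | false = id
    good′ : ∀ u → Good u (placed-outdegree (suc s) u) (S′ u)
    good′ u with T? (H.adj u v)
    ... | yes e = subst₂ (Good u) (sym (placed-outdegree-edge e)) (sym (S′-edge e)) (goodw e)
    ... | no ¬e = subst₂ (Good u) (sym (placed-outdegree-nonedge ¬e)) (sym (S′-nonedge ¬e)) (good u)
    compatible′ : ∀ {u x y} → u H.⟶ x → toℕ (key x) < suc s → T (S′ u y) → y T′.⟶ f′ x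
    compatible′ {u} {x} {y} e lt Sy with x Fin.≟ v
    ... | yes refl = subst (y T′.⟶_) (sym new) (proj₂ (∧⁻ {S u y} (subst (λ A → T (A y)) (S′-edge e) Sy)))
    ... | no x≢v = subst (y T′.⟶_) (sym (old x≢v)) (compatible e (<suc-elim lt x≢v) (S′⊆S u Sy))
    edges′ : ∀ {u x} → u H.⟶ x → toℕ (key u) < suc s → f′ u T′.⟶ f′ x
    edges′ {u} {x} e lt with x Fin.≟ v | u Fin.≟ v
    -- The new vertex cannot be the head, since the tail would have a larger key and be unplaced.
    -- When it is the tail, `compatible` provides the edge.
    ... | yes refl | _ = contradiction (key-decreasing e) (≤⇒≯ (≤-pred lt))
    ... | no x≢v | yes refl = subst₂ T′._⟶_ (sym new) (sym (old x≢v)) (compatible e (key-decreasing e) Svw)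
    ... | no x≢v | no u≢v = subst₂ T′._⟶_ (sym (old u≢v)) (sym (old x≢v)) (edges e (<suc-elim lt u≢v))
    injective′ : ∀ {u x} → toℕ (key u) < suc s → toℕ (key x) < suc s → f′ u ≡ f′ x → u ≡ x
    injective′ {u} {x} lt lt′ eq with u Fin.≟ v | x Fin.≟ v
    ... | yes refl | yes refl = refl
    ... | yes refl | no x≢v = contradiction (trans (sym (old x≢v)) (trans (sym eq) new)) (fresh x)
    ... | no u≢v | yes refl = contradiction (trans (sym (old u≢v)) (trans eq new)) (fresh u)
    ... | no u≢v | no x≢v = injective (<suc-elim lt u≢v) (<suc-elim lt′ x≢v)
                              (trans (sym (old u≢v)) (trans eq (old x≢v)))

  -- `w₀` is the junk value of the map before anything is placed. The procedure is run twice: with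
  -- exit `Split X` in `copy-or-split`, where candidate sets shrink by factors, and with exit `⊥` in
  -- `copy-in-chain`, where losses add up.
  embed : (S₀ : Fin n → Sub N) → (∀ u → Good u 0 (S₀ u)) → Fin N → Exit ⊎ Copy H T′
  embed S₀ good₀ w₀ = [ inj₁ , (λ st → inj₂ (copy st)) ]′ (run K)
    where
    start : Stage 0
    start = record
      { f = λ _ → w₀ ; S = S₀
      ; good = λ u → subst (λ d → Good u d (S₀ u)) (sym (empty u)) (good₀ u)
      ; compatible = λ _ () ; edges = λ _ () ; injective = λ () }
      where
      empty : ∀ u → placed-outdegree 0 u ≡ 0
      empty u = n≤0⇒n≡0 (≤-trans (sum-mono {g = λ _ → 0} λ x → ⟦⟧-mono {H.adj u x ∧ false} {false} (proj₂ ∘ ∧⁻ {H.adj u x}))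
                                 (≤-reflexive (trans (sum-const n 0) (*-zeroʳ n))))
    run : ∀ s → Exit ⊎ Stage s
    run zero = inj₂ start
    run (suc s) with run s
    ... | inj₁ exit = inj₁ exit
    ... | inj₂ st with Fin.any? (λ x → toℕ (key x) ≟ s)
    ...   | yes (v , refl) = place v st
    ...   | no none = inj₂ (skip (λ x eq → none (x , eq)) st)
    copy : Stage K → Copy H T′
    copy st = f , injective (Fin.toℕ<n _) (Fin.toℕ<n _) , λ e → edges e (Fin.toℕ<n _)
      where open Stage st

-- Choosing a vertex outside small sets; non-neighbours in a tournament.

n<m^n : ∀ {m} → 2 ≤ m → ∀ n → n < m ^ n
n<m^n 2≤m zero    = ≤-refl
n<m^n {m} 2≤m (suc n) = begin
  suc (suc n)   ≤⟨ s≤s (m≤n+m (suc n) n) ⟩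
  suc n + suc n ≡⟨ cong (suc n +_) (+-identityʳ (suc n)) ⟨
  2 * suc n     ≤⟨ *-mono-≤ 2≤m (n<m^n 2≤m n) ⟩
  m * m ^ n     ∎
  where open ≤-Reasoning

⟦⟧≡0 : ∀ {b} → ⟦ b ⟧ < 1 → ¬ T b
⟦⟧≡0 {true} (s≤s ()) _

term≤sum : (f : Fin n → ℕ) (i : Fin n) → f i ≤ sum f
term≤sum f zero    = m≤m+n (f zero) _
term≤sum f (suc i) = ≤-trans (term≤sum (f ∘ suc) i) (m≤n+m _ (f zero))

-- Union bound: summed over all `w`, `hits` contributes exactly `n` and `errs` the sizes of the bad
-- sets, so at some `w` in `S` both vanish.
avoid : (f : Fin n → Fin N) (bad : Fin k → Sub N) (S : Sub N) → n + sum (λ u → # bad u) < # S →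
  ∃[ w ] (T (S w) × (∀ x → f x ≢ w) × (∀ u → ¬ T (bad u w)))
avoid {n} {N} {k} f bad S small =
  let w , lt = sum-<⇒∃ (λ w → hits w + errs w) (λ w → ⟦ S w ⟧) (subst (_< # S) (sym total) small)
      Sw = in-S lt
      zeros = subst (hits w + errs w <_) (cong ⟦_⟧ (T-ext {S w} {true} _ (λ _ → Sw))) lt
  in w , Sw
   , (λ x eq → ⟦⟧≡0 {does (f x Fin.≟ w)} (≤-<-trans (≤-trans (term≤sum _ x) (m≤m+n (hits w) _)) zeros) (hit eq))
   , (λ u → ⟦⟧≡0 (≤-<-trans (≤-trans (term≤sum (λ u → ⟦ bad u w ⟧) u) (m≤n+m _ (hits w))) zeros))
  where
  hits errs : Fin N → ℕ
  hits w = sum (λ x → ⟦ does (f x Fin.≟ w) ⟧)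
  errs w = sum (λ u → ⟦ bad u w ⟧)
  hit : ∀ {x w} → f x ≡ w → T (does (f x Fin.≟ w))
  hit {x} {w} eq with f x Fin.≟ w
  ... | yes _ = tt
  ... | no ne = ne eq
  in-S : ∀ {b a} → a < ⟦ b ⟧ → T b
  in-S {true} _ = tt
  total : sum (λ w → hits w + errs w) ≡ n + sum (λ u → # bad u)
  total = begin
    sum (λ w → hits w + errs w)   ≡⟨ ∑-distrib-+ hits errs ⟩
    sum hits + sum errs           ≡⟨ cong₂ _+_ (∑-comm (λ w x → ⟦ does (f x Fin.≟ w) ⟧)) (∑-comm (λ w u → ⟦ bad u w ⟧)) ⟩
    sum (λ x → sum (λ w → ⟦ does (f x Fin.≟ w) ⟧)) + sum (λ u → # bad u)
      ≡⟨ cong (_+ sum (λ u → # bad u)) (trans (sum-cong-≗ (λ x → sum-δ (f x))) (trans (sum-const n 1) (*-identityʳ n))) ⟩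
    n + sum (λ u → # bad u) ∎
    where open ≡-Reasoning

module _ (T′ : Tournament N) where
  private
    module T′ = Tournament T′

  -- A vertex that receives no edge from `a` is `a` itself, whence the `suc`, or sends an edge to
  -- `a` by totality.
  non-out⊆in : ∀ (S : Sub N) a → # (S ∖ T′.adj a) ≤ suc (# (S ∩ λ y → T′.adj y a))
  non-out⊆in S a = begin
    # (S ∖ T′.adj a)
      ≤⟨ sum-mono pointwise ⟩
    sum (λ y → ⟦ does (a Fin.≟ y) ⟧ + ⟦ S y ∧ T′.adj y a ⟧)
      ≡⟨ ∑-distrib-+ (λ y → ⟦ does (a Fin.≟ y) ⟧) (λ y → ⟦ S y ∧ T′.adj y a ⟧) ⟩
    sum (λ y → ⟦ does (a Fin.≟ y) ⟧) + # (S ∩ λ y → T′.adj y a)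
      ≡⟨ cong (_+ # (S ∩ λ y → T′.adj y a)) (sum-δ a) ⟩
    suc (# (S ∩ λ y → T′.adj y a)) ∎
    where
    open ≤-Reasoning
    pointwise : ∀ y → ⟦ S y ∧ not (T′.adj a y) ⟧ ≤ ⟦ does (a Fin.≟ y) ⟧ + ⟦ S y ∧ T′.adj y a ⟧
    pointwise y with a Fin.≟ y
    ... | yes _ = ≤-trans (⟦⟧-mono {S y ∧ not (T′.adj a y)} {true} _) (s≤s z≤n)
    ... | no a≢y with T′.adj a y | T′.total a≢y
    ...   | true  | _      = ⟦⟧-mono {S y ∧ false} {S y ∧ _} (⊥-elim ∘ proj₂ ∘ ∧⁻ {S y})
    ...   | false | inj₂ e = ⟦⟧-mono {S y ∧ true} {S y ∧ _} (λ t → ∧⁺ (proj₁ (∧⁻ {S y} t)) e)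

-- A copy of the digraph, or a dense pair of sets.

module Embedding {n N K} (H : Digraph n) (T′ : Tournament N) (Δ : ℕ) (1≤Δ : 1 ≤ Δ) (1≤n : 1 ≤ n)
  (degree≤Δ : ∀ v → # Digraph.adj H v + # (λ u → Digraph.adj H u v) ≤ Δ)
  (key : Fin n → Fin K) (key-injective : ∀ {u v} → key u ≡ key v → u ≡ v)
  (key-decreasing : ∀ {u v} → Digraph._⟶_ H u v → key v Fin.< key u)
  where
  private
    module H = Digraph H
    module T′ = Tournament T′

  -- A blocked step gives a defect of `1/(8Δ)`. Counting the vertex itself in `non-out⊆in` raises it
  -- to `1/(4Δ)`, and the averaging in `most-have-few-exceptions` to `1/(2Δ)`. With at most `Δ`
  -- out-neighbours this still leaves half of every candidate set in `copy-in-chain`.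
  q : ℕ
  q = 8 * Δ

  2≤q : 2 ≤ q
  2≤q = ≤-trans (s≤s (s≤s z≤n)) (*-monoʳ-≤ 8 1≤Δ)

  instance
    q≢0 : NonZero q
    q≢0 = >-nonZero (<-trans (s≤s z≤n) 2≤q)

  outdegree≤Δ : ∀ v → # H.adj v ≤ Δ
  outdegree≤Δ v = ≤-trans (m≤m+n _ _) (degree≤Δ v)

  -- The factor 2 in `B-large` compensates for the half of `B` that may be discarded in forming
  -- `B′`, so that both recursive calls in `copy-or-chain` start from at least `# X / q ^ Δ`
  -- vertices.
  record Split (X : Sub N) : Set where
    field
      A B     : Sub N
      A⊆X     : A ⊆ X
      B⊆X     : B ⊆ X
      A-large : # X ≤ # A * q ^ Δ
      B-large : 2 * # X ≤ # B * q ^ Δ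
      dense   : ∀ a → T (A a) → 2 * (2 * Δ) * # (B ∖ T′.adj a) ≤ # B

  module _ (X : Sub N) (X-large : q ^ Δ * (4 * n) ≤ # X) where

    Good : Fin n → ℕ → Sub N → Set
    Good _ d S = S ⊆ X × # X ≤ # S * q ^ d

    n*q^Δ<#X : n * q ^ Δ < # X
    n*q^Δ<#X = begin-strict
      n * q ^ Δ       ≡⟨ *-comm n _ ⟩
      q ^ Δ * n       <⟨ *-monoʳ-< (q ^ Δ) {{m^n≢0 q Δ}} (m<m*n n 4 {{>-nonZero 1≤n}} (s≤s (s≤s z≤n))) ⟩
      q ^ Δ * (n * 4) ≡⟨ cong (q ^ Δ *_) (*-comm n 4) ⟩
      q ^ Δ * (4 * n) ≤⟨ X-large ⟩
      # X             ∎
      where open ≤-Reasoning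

    -- As `d < Δ`, one factor `q` is left over. The bound absorbs the additional 1 from
    -- `non-out⊆in`.
    q≤#S : ∀ {u d S} → Good u d S → d < Δ → q ≤ # S
    q≤#S {u} {d} {S} (_ , X≤) d<Δ = *-cancelʳ-≤ q (# S) (q ^ d) {{m^n≢0 q d}} (begin
      q ^ suc d ≤⟨ ^-monoʳ-≤ q d<Δ ⟩
      q ^ Δ     ≤⟨ m≤n*m (q ^ Δ) n {{>-nonZero 1≤n}} ⟩
      n * q ^ Δ ≤⟨ <⇒≤ n*q^Δ<#X ⟩
      # X       ≤⟨ X≤ ⟩
      # S * q ^ d ∎)
      where open ≤-Reasoning

    -- A candidate `w` is unsuitable for an in-neighbour `u` of `v` when less than a `1/q` fraction
    -- of `S u` sends edges to it. If for some `u` there are at least `# X / q ^ Δ` such `w`, they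
    -- and `S u` form the split. Otherwise they cannot exhaust `S v`.
    choose : (f : Fin n → Fin N) (S : Fin n → Sub N) (d : Fin n → ℕ) (v : Fin n) →
      (∀ u → Good u (d u) (S u)) → d v ≡ # H.adj v → (∀ {u} → u H.⟶ v → d u < # H.adj u) →
      Split X ⊎ ∃[ w ] (T (S v w) × (∀ x → f x ≢ w) ×
        (∀ {u} → u H.⟶ v → Good u (suc (d u)) (S u ∩ λ x → T′.adj x w)))
    choose f S d v good dv du
      with Fin.any? (λ u → T? (H.adj u v) ×-dec (# X ≤? # (λ w → S v w ∧ (q * # (S u ∩ λ x → T′.adj x w) <ᵇ # S u)) * q ^ Δ))
    ... | yes (u , e , many) = inj₁ record
      { A = λ w → S v w ∧ (q * # (S u ∩ λ x → T′.adj x w) <ᵇ # S u)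
      ; B = S u
      ; A⊆X = λ {i} t → proj₁ (good v) (proj₁ (∧⁻ {S v i} t))
      ; B⊆X = proj₁ (good u)
      ; A-large = many
      ; B-large = B-large
      ; dense = λ a t → dense a (<ᵇ⇒< _ _ (proj₂ (∧⁻ {S v a} t)))
      }
      where
      open ≤-Reasoning
      du<Δ : d u < Δ
      du<Δ = ≤-trans (du e) (outdegree≤Δ u)
      B-large : 2 * # X ≤ # S u * q ^ Δ
      B-large = begin
        -- The spare factor `q` coming from `d u < Δ` is at least 2.
        2 * # X                  ≤⟨ *-mono-≤ 2≤q (proj₂ (good u)) ⟩
        q * (# S u * q ^ d u)    ≡⟨ swap q (# S u) (q ^ d u) ⟩
        # S u * q ^ suc (d u)    ≤⟨ *-monoʳ-≤ (# S u) (^-monoʳ-≤ q du<Δ) ⟩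
        # S u * q ^ Δ            ∎
        where
        swap : ∀ a b c → a * (b * c) ≡ b * (a * c)
        swap = solve-∀
      dense : ∀ a → q * # (S u ∩ λ x → T′.adj x a) < # S u → 2 * (2 * Δ) * # (S u ∖ T′.adj a) ≤ # S u
      dense a lt = *-cancelˡ-≤ 2 (begin
        2 * (2 * (2 * Δ) * # (S u ∖ T′.adj a))
          ≤⟨ *-monoʳ-≤ 2 (*-monoʳ-≤ (2 * (2 * Δ)) (non-out⊆in T′ (S u) a)) ⟩
        2 * (2 * (2 * Δ) * suc (# (S u ∩ λ x → T′.adj x a)))
          ≡⟨ expand Δ _ ⟩
        q + q * # (S u ∩ λ x → T′.adj x a)
          ≤⟨ +-mono-≤ (q≤#S {u} (good u) du<Δ) (<⇒≤ lt) ⟩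
        # S u + # S u
          ≡⟨ cong (# S u +_) (+-identityʳ (# S u)) ⟨
        2 * # S u ∎)
        where
        expand : ∀ a b → 2 * (2 * (2 * a) * suc b) ≡ 8 * a + 8 * a * b
        expand = solve-∀
    ... | no none = inj₂ (w , Sw , fresh , λ {u} e → extend u e)
      where
      open ≤-Reasoning
      few : Fin n → Sub N
      few u w = S v w ∧ (q * # (S u ∩ λ x → T′.adj x w) <ᵇ # S u)
      bad : Fin n → Sub N
      bad u w = H.adj u v ∧ few u w
      indegree : ℕ
      indegree = # (λ u → H.adj u v)
      bad-small : ∀ u → # bad u * q ^ Δ ≤ ⟦ H.adj u v ⟧ * # X
      bad-small u with H.adj u v in eq
      ... | false = ≤-reflexive (cong (_* q ^ Δ) (trans (sum-const N 0) (*-zeroʳ N)))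
      ... | true  = ≤-trans (≰⇒≥ (λ le → none (u , subst T (sym eq) tt , le))) (≤-reflexive (sym (+-identityʳ (# X))))
      -- Take `# X / q ^ Δ` as the unit. The image of `f` takes less than one unit and each of the
      -- `indegree` bad sets at most one. `S v` has at least `q ^ indegree` units, because
      -- out-degree and in-degree together are at most `Δ`.
      room : n + sum (λ u → # bad u) < # S v
      room = *-cancelʳ-< (q ^ Δ) _ _ (begin-strict
        (n + sum (λ u → # bad u)) * q ^ Δ
          ≡⟨ *-distribʳ-+ (q ^ Δ) n _ ⟩
        n * q ^ Δ + sum (λ u → # bad u) * q ^ Δ
          ≡⟨ cong (n * q ^ Δ +_) (*-distribʳ-sum (q ^ Δ) (λ u → # bad u)) ⟩
        n * q ^ Δ + sum (λ u → # bad u * q ^ Δ)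
          ≤⟨ +-monoʳ-≤ (n * q ^ Δ) (sum-mono bad-small) ⟩
        n * q ^ Δ + sum (λ u → ⟦ H.adj u v ⟧ * # X)
          ≡⟨ cong (n * q ^ Δ +_) (*-distribʳ-sum (# X) (λ u → ⟦ H.adj u v ⟧)) ⟨
        n * q ^ Δ + indegree * # X
          <⟨ +-monoˡ-< (indegree * # X) n*q^Δ<#X ⟩
        suc indegree * # X
          ≤⟨ *-mono-≤ (n<m^n 2≤q indegree) (proj₂ (good v)) ⟩
        q ^ indegree * (# S v * q ^ d v)
          ≡⟨ cong (λ x → q ^ indegree * (# S v * q ^ x)) dv ⟩
        q ^ indegree * (# S v * q ^ # H.adj v)
          ≡⟨ swap (q ^ indegree) (# S v) (q ^ # H.adj v) ⟩
        # S v * (q ^ # H.adj v * q ^ indegree)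
          ≡⟨ cong (# S v *_) (^-distribˡ-+-* q (# H.adj v) indegree) ⟨
        # S v * q ^ (# H.adj v + indegree)
          ≤⟨ *-monoʳ-≤ (# S v) (^-monoʳ-≤ q (degree≤Δ v)) ⟩
        # S v * q ^ Δ ∎)
        where
        swap : ∀ a b c → a * (b * c) ≡ b * (c * a)
        swap = solve-∀
      picked = avoid f bad (S v) room
      w = proj₁ picked
      Sw = proj₁ (proj₂ picked)
      fresh = proj₁ (proj₂ (proj₂ picked))
      extend : ∀ u → u H.⟶ v → Good u (suc (d u)) (S u ∩ λ x → T′.adj x w)
      extend u e = (λ {i} t → proj₁ (good u) (proj₁ (∧⁻ {S u i} t))) , (begin
        # X                              ≤⟨ proj₂ (good u) ⟩
        # S u * q ^ d u                  ≤⟨ *-monoˡ-≤ (q ^ d u) enough ⟩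
        q * # (S u ∩ λ x → T′.adj x w) * q ^ d u  ≡⟨ swap q _ (q ^ d u) ⟩
        # (S u ∩ λ x → T′.adj x w) * q ^ suc (d u) ∎)
        where
        swap : ∀ a b c → a * b * c ≡ b * (a * c)
        swap = solve-∀
        enough : # S u ≤ q * # (S u ∩ λ x → T′.adj x w)
        enough = ≮⇒≥ (λ lt → proj₂ (proj₂ (proj₂ picked)) u (∧⁺ e (∧⁺ Sw (<⇒<ᵇ lt))))

    copy-or-split : Split X ⊎ Copy H T′
    copy-or-split = embed (λ _ → X) (λ _ → id , ≤-reflexive (sym (*-identityʳ (# X))))
                          (proj₁ (#-inhabited X (≤-<-trans z≤n n*q^Δ<#X)))
      where open Greedy H T′ key key-injective key-decreasing Good (Split X) choose

  -- Chains of sets, each sending nearly all edges to the next.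

  Link : Sub N → Sub N → Set
  Link A B = ∀ {b} → T (B b) → 2 * Δ * # (A ∖ λ a → T′.adj a b) ≤ # A

  data Chain : ℕ → Sub N → Sub N → Set where
    [_]    : ∀ {A} → 4 * n ≤ # A → Chain 1 A A
    _∷⟨_⟩_ : ∀ {k A B C} → 4 * n ≤ # A → Link A B → Chain k B C → Chain (suc k) A C

  _++⟨_⟩_ : ∀ {k l A B C D} → Chain k A B → Link B C → Chain l C D → Chain (k + l) A D
  [ A ] ++⟨ B→C ⟩ d           = A ∷⟨ B→C ⟩ d
  (A ∷⟨ A→ ⟩ c) ++⟨ B→C ⟩ d = A ∷⟨ A→ ⟩ (c ++⟨ B→C ⟩ d)

  last-large : ∀ {k A B} → Chain k A B → 4 * n ≤ # B
  last-large [ A ]          = A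
  last-large (_ ∷⟨ _ ⟩ c) = last-large c

  -- Junk value: beyond the end of the chain, nth returns the last set.
  nth : ∀ {k A B} → Chain k A B → ℕ → Sub N
  nth {A = A} [ _ ]          _       = A
  nth {A = A} (_ ∷⟨ _ ⟩ c) zero    = A
  nth         (_ ∷⟨ _ ⟩ c) (suc i) = nth c i

  nth-large : ∀ {k A B} (c : Chain k A B) i → 4 * n ≤ # (nth c i)
  nth-large [ A ]          _       = A
  nth-large (A ∷⟨ _ ⟩ c) zero    = A
  nth-large (_ ∷⟨ _ ⟩ c) (suc i) = nth-large c i

  nth-first : ∀ {k A B} (c : Chain k A B) → nth c 0 ≡ A
  nth-first [ _ ]          = refl
  nth-first (_ ∷⟨ _ ⟩ _) = refl

  nth-link : ∀ {k A B} (c : Chain k A B) i → suc i < k → Link (nth c i) (nth c (suc i))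
  nth-link [ _ ]            i       (s≤s ())
  nth-link (_ ∷⟨ A→B ⟩ c) zero    _         {b} t = A→B (subst (λ S → T (S b)) (nth-first c) t)
  nth-link (_ ∷⟨ _ ⟩ c)   (suc i) (s≤s i<k) = nth-link c i i<k

  0<4n : 0 < 4 * n
  0<4n = ≤-trans 1≤n (m≤n*m n 4)

  -- A `Link` survives shrinking its second set but not its first, whereas `dense` in a `Split`
  -- survives shrinking `A` but not `B`. So the half inside `A` comes first; its last set `L` then
  -- determines `B′`, all of whose subsets are linked to `L`. The inclusions are returned to make
  -- this link available.
  copy-or-chain : ∀ j (X : Sub N) → (q ^ Δ) ^ j * (4 * n) ≤ # X →
    Copy H T′ ⊎ ∃[ F ] ∃[ L ] (F ⊆ X × L ⊆ X × Chain (2 ^ j) F L)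
  copy-or-chain zero X large = inj₂ (X , X , id , id , [ subst (_≤ # X) (+-identityʳ (4 * n)) large ])
  copy-or-chain (suc j) X large with copy-or-split X (≤-trans (*-monoʳ-≤ (q ^ Δ) (m≤n*m (4 * n) ((q ^ Δ) ^ j) {{m^n≢0 _ j {{m^n≢0 q Δ}}}}))
                                                      (≤-trans (≤-reflexive (sym (*-assoc (q ^ Δ) _ _))) large))
  ... | inj₂ copy = inj₁ copy
  ... | inj₁ split = first (copy-or-chain j A (shrink A A-large))
    where
    open Split split
    open ≤-Reasoning
    shrink : ∀ (Y : Sub N) → # X ≤ # Y * q ^ Δ → (q ^ Δ) ^ j * (4 * n) ≤ # Y
    shrink Y X≤Y = *-cancelˡ-≤ (q ^ Δ) {{m^n≢0 q Δ}} (begin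
      q ^ Δ * ((q ^ Δ) ^ j * (4 * n)) ≡⟨ *-assoc (q ^ Δ) _ _ ⟨
      q ^ Δ * (q ^ Δ) ^ j * (4 * n)   ≤⟨ large ⟩
      # X                             ≤⟨ X≤Y ⟩
      # Y * q ^ Δ                     ≡⟨ *-comm (# Y) _ ⟩
      q ^ Δ * # Y                     ∎)
    first : Copy H T′ ⊎ ∃[ F ] ∃[ L ] (F ⊆ A × L ⊆ A × Chain (2 ^ j) F L) →
            Copy H T′ ⊎ ∃[ F ] ∃[ L ] (F ⊆ X × L ⊆ X × Chain (2 ^ suc j) F L)
    first (inj₁ copy) = inj₁ copy
    first (inj₂ (F , L , F⊆A , L⊆A , c)) = second (copy-or-chain j B′ (shrink B′ B′-large))
      where
      B′ : Sub N
      B′ b = B b ∧ (2 * Δ * # (L ∖ λ a → T′.adj a b) ≤ᵇ # L)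
      B′-large : # X ≤ # B′ * q ^ Δ
      B′-large = *-cancelˡ-≤ 2 (begin
        2 * # X            ≤⟨ B-large ⟩
        # B * q ^ Δ        ≤⟨ *-monoˡ-≤ (q ^ Δ) (most-have-few-exceptions L B T′.adj (2 * Δ)
                                (≤-trans 0<4n (last-large c)) (λ a t → dense a (L⊆A t))) ⟩
        2 * # B′ * q ^ Δ   ≡⟨ *-assoc 2 (# B′) _ ⟩
        2 * (# B′ * q ^ Δ) ∎)
      second : Copy H T′ ⊎ ∃[ F ] ∃[ L ] (F ⊆ B′ × L ⊆ B′ × Chain (2 ^ j) F L) →
               Copy H T′ ⊎ ∃[ F ] ∃[ L ] (F ⊆ X × L ⊆ X × Chain (2 ^ suc j) F L)
      second (inj₁ copy) = inj₁ copy
      second (inj₂ (F′ , L′ , F′⊆B′ , L′⊆B′ , c′)) = inj₂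
        ( F , L′ , (λ t → A⊆X (F⊆A t)) , (λ {i} t → B⊆X (proj₁ (∧⁻ {B i} (L′⊆B′ t))))
        , subst (λ k → Chain k F L′) (cong (2 ^ j +_) (sym (+-identityʳ (2 ^ j))))
                (c ++⟨ (λ {b} t → ≤ᵇ⇒≤ _ _ (proj₂ (∧⁻ {B b} (F′⊆B′ t)))) ⟩ c′))

  -- Embedding into a chain, one level per set.

  module _ (level : Fin n → ℕ) (consecutive : ∀ {u v} → u H.⟶ v → level v ≡ suc (level u)) where

    -- Each vertex starts with the whole set of its level, and a placed out-neighbour removes at
    -- most a `1/(2Δ)` fraction of that set. At most `Δ` out-neighbours leave half of it, at least
    -- `2 * n` vertices, so no step is blocked and the exit can be `⊥`.
    copy-in-chain : ∀ {k F L} → Chain k F L → (∀ u → level u < k) → Copy H T′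
    copy-in-chain {k} c level<k = [ ⊥-elim , id ]′
      (embed A (λ u → id , m≤m+n _ _) (proj₁ (#-inhabited (nth c 0) (≤-trans 0<4n (nth-large c 0)))))
      where
      A : Fin n → Sub N
      A u = nth c (level u)
      -- The inequality says `# S ≥ (1 - d / (2 * Δ)) * # (A u)` without subtraction.
      Fit : Fin n → ℕ → Sub N → Set
      Fit u d S = S ⊆ A u × # (A u) * (2 * Δ) ≤ # S * (2 * Δ) + d * # (A u)
      link : ∀ {u v} → u H.⟶ v → Link (A u) (A v)
      link {u} {v} e {b} t = nth-link c (level u) (subst (_< k) (consecutive e) (level<k v))
                               (subst (λ l → T (nth c l b)) (consecutive e) t)
      open ≤-Reasoning
      pick : (f : Fin n → Fin N) (S : Fin n → Sub N) (d : Fin n → ℕ) (v : Fin n) →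
        (∀ u → Fit u (d u) (S u)) → d v ≡ # H.adj v → (∀ {u} → u H.⟶ v → d u < # H.adj u) →
        ⊥ ⊎ ∃[ w ] (T (S v w) × (∀ x → f x ≢ w) ×
          (∀ {u} → u H.⟶ v → Fit u (suc (d u)) (S u ∩ λ x → T′.adj x w)))
      pick f S d v fit dv du =
        let w , Sw , fresh , _ = avoid {k = 0} f (λ ()) (S v) room
        in inj₂ (w , Sw , fresh , λ {u} e → extend u w e (proj₁ (fit v) Sw))
        where
        half : # (A v) ≤ 2 * # (S v)
        half = *-cancelʳ-≤ _ _ Δ {{>-nonZero 1≤Δ}} (+-cancelʳ-≤ (# (A v) * Δ) _ _ (begin
          # (A v) * Δ + # (A v) * Δ          ≡⟨ double (# (A v)) Δ ⟩
          # (A v) * (2 * Δ)                  ≤⟨ proj₂ (fit v) ⟩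
          # (S v) * (2 * Δ) + d v * # (A v)  ≤⟨ +-monoʳ-≤ (# (S v) * (2 * Δ)) (*-monoˡ-≤ (# (A v))
                                                  (subst (_≤ Δ) (sym dv) (outdegree≤Δ v))) ⟩
          # (S v) * (2 * Δ) + Δ * # (A v)    ≡⟨ regroup (# (S v)) Δ (# (A v)) ⟩
          2 * # (S v) * Δ + # (A v) * Δ      ∎))
          where
          double : ∀ a b → a * b + a * b ≡ a * (2 * b)
          double = solve-∀
          regroup : ∀ s b a → s * (2 * b) + b * a ≡ 2 * s * b + a * b
          regroup = solve-∀
        room : n + 0 < # (S v)
        room = begin-strict
          n + 0     ≡⟨ +-identityʳ n ⟩
          n         <⟨ m<m*n n 2 {{>-nonZero 1≤n}} (s≤s (s≤s z≤n)) ⟩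
          n * 2     ≡⟨ *-comm n 2 ⟩
          2 * n     ≤⟨ *-cancelˡ-≤ 2 (begin
            2 * (2 * n)    ≡⟨ *-assoc 2 2 n ⟨
            4 * n          ≤⟨ nth-large c (level v) ⟩
            # (A v)        ≤⟨ half ⟩
            2 * # (S v)    ∎) ⟩
          # (S v)   ∎
        extend : ∀ u w → u H.⟶ v → T (A v w) → Fit u (suc (d u)) (S u ∩ λ x → T′.adj x w)
        extend u w e Aw = (λ {i} t → proj₁ (fit u) (proj₁ (∧⁻ {S u i} t))) , (begin
          # (A u) * (2 * Δ)
            ≤⟨ proj₂ (fit u) ⟩
          # (S u) * (2 * Δ) + d u * # (A u)
            ≡⟨ cong (λ x → x * (2 * Δ) + d u * # (A u)) (#-split (S u) N⁻w) ⟩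
          (# (S u ∩ N⁻w) + # (S u ∖ N⁻w)) * (2 * Δ) + d u * # (A u)
            ≡⟨ regroup (# (S u ∩ N⁻w)) _ (2 * Δ) (d u * # (A u)) ⟩
          # (S u ∩ N⁻w) * (2 * Δ) + (2 * Δ * # (S u ∖ N⁻w) + d u * # (A u))
            -- The loss is measured against the original set `A u`, since `Link` says nothing about
            -- its subsets.
            ≤⟨ +-monoʳ-≤ (# (S u ∩ N⁻w) * (2 * Δ)) (+-monoˡ-≤ (d u * # (A u)) (begin
              2 * Δ * # (S u ∖ N⁻w)   ≤⟨ *-monoʳ-≤ (2 * Δ) (#-mono {A = S u ∖ N⁻w} {A u ∖ N⁻w} λ {i} t →
                                            let Su , off = ∧⁻ {S u i} t in ∧⁺ (proj₁ (fit u) Su) off) ⟩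
              2 * Δ * # (A u ∖ N⁻w)   ≤⟨ link e Aw ⟩
              # (A u)                 ∎)) ⟩
          # (S u ∩ N⁻w) * (2 * Δ) + suc (d u) * # (A u) ∎)
          where
          N⁻w : Sub N
          N⁻w x = T′.adj x w
          regroup : ∀ a b c d → (a + b) * c + d ≡ a * c + (c * b + d)
          regroup = solve-∀
      open Greedy H T′ key key-injective key-decreasing Fit ⊥ pick

    copy-in-large : ∀ j → (∀ u → level u < 2 ^ j) → (q ^ Δ) ^ j * (4 * n) ≤ N → Copy H T′
    copy-in-large j level< large
      with copy-or-chain j (λ _ → true) (≤-trans large (≤-reflexive (sym (trans (sum-const N 1) (*-identityʳ N)))))
    ... | inj₁ copy = copy
    ... | inj₂ (_ , _ , _ , _ , c) = copy-in-chain c level<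

-- Maximum degree one.

#≤1⇒unique : (S : Sub N) → # S ≤ 1 → ∀ {i j} → T (S i) → T (S j) → i ≡ j
#≤1⇒unique S S≤1 {i} {j} Si Sj with i Fin.≟ j
... | yes i≡j = i≡j
... | no i≢j = contradiction (≤-trans two S≤1) λ { (s≤s ()) }
  where
  pointwise : ∀ x → ⟦ does (i Fin.≟ x) ⟧ + ⟦ does (j Fin.≟ x) ⟧ ≤ ⟦ S x ⟧
  pointwise x with i Fin.≟ x | j Fin.≟ x
  ... | yes refl | yes refl = contradiction refl i≢j
  ... | yes refl | no _     = ⟦⟧-mono {true} (λ _ → Si)
  ... | no _     | yes refl = ⟦⟧-mono {true} (λ _ → Sj)
  ... | no _     | no _     = z≤n
  two : 2 ≤ # S
  two = ≤-trans (≤-reflexive (sym (trans (∑-distrib-+ (λ x → ⟦ does (i Fin.≟ x) ⟧) (λ x → ⟦ does (j Fin.≟ x) ⟧))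
                                         (cong₂ _+_ (sum-δ i) (sum-δ j)))))
                (sum-mono pointwise)

member⇒0<# : (S : Sub N) {i : Fin N} → T (S i) → 0 < # S
member⇒0<# S {i} Si = ≤-trans (⟦⟧-mono {true} {S i} (λ _ → Si)) (term≤sum (λ j → ⟦ S j ⟧) i)

-- The components of H are single vertices and single edges, and an edge which T′
-- orients the wrong way is embedded with its endpoints exchanged.
module Matching {n} (H : Digraph n) (T′ : Tournament n)
  (degree≤1 : ∀ v → # Digraph.adj H v + # (λ u → Digraph.adj H u v) ≤ 1) where
  private
    module H = Digraph H
    module T′ = Tournament T′

  head-unique : ∀ {u v w} → u H.⟶ v → u H.⟶ w → v ≡ w
  head-unique {u} = #≤1⇒unique (H.adj u) (≤-trans (m≤m+n _ _) (degree≤1 u))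

  tail-unique : ∀ {u v w} → v H.⟶ u → w H.⟶ u → v ≡ w
  tail-unique {u} = #≤1⇒unique (λ x → H.adj x u) (≤-trans (m≤n+m _ (# H.adj u)) (degree≤1 u))

  no-2-path : ∀ {u v w} → u H.⟶ v → ¬ v H.⟶ w
  no-2-path {u} {v} uv vw =
    contradiction (≤-trans (+-mono-≤ (member⇒0<# (H.adj v) vw) (member⇒0<# (λ x → H.adj x v) uv)) (degree≤1 v)) λ { (s≤s ()) }

  out? : ∀ w → Dec (∃[ v ] w H.⟶ v)
  out? w = Fin.any? λ v → T? (H.adj w v)

  in? : ∀ w → Dec (∃[ u ] u H.⟶ w)
  in? w = Fin.any? λ u → T? (H.adj u w)

  f : Fin n → Fin n
  f w with out? w | in? w
  ... | yes (v , _) | _           = if T′.adj w v then w else v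
  ... | no _        | yes (u , _) = if T′.adj u w then w else u
  ... | no _        | no _        = w

  f-tail : ∀ {u v} → u H.⟶ v → f u ≡ (if T′.adj u v then u else v)
  f-tail {u} {v} e with out? u | in? u
  ... | yes (w , e′) | _ rewrite head-unique e e′ = refl
  ... | no none | _ = contradiction (v , e) none

  f-head : ∀ {u v} → u H.⟶ v → f v ≡ (if T′.adj u v then v else u)
  f-head {u} {v} e with out? v | in? v
  ... | yes (_ , e′) | _ = contradiction e′ (no-2-path e)
  ... | no _ | yes (w , e′) rewrite tail-unique e e′ = refl
  ... | no _ | no none = contradiction (u , e) none

  f-isolated : ∀ {w} → ¬ (∃[ v ] w H.⟶ v) → ¬ (∃[ u ] u H.⟶ w) → f w ≡ w
  f-isolated {w} ¬out ¬in with out? w | in? w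
  ... | yes o | _ = contradiction o ¬out
  ... | no _ | yes i = contradiction i ¬in
  ... | no _ | no _ = refl

  -- The two ends of an edge are fixed or exchanged, and isolated vertices are fixed. In `copy` this
  -- yields injectivity.
  f-involutive : ∀ w → f (f w) ≡ w
  f-involutive w with out? w | in? w
  ... | yes (v , e) | _ = tail (T′.adj w v) refl
    where
    tail : ∀ b → T′.adj w v ≡ b → f (if T′.adj w v then w else v) ≡ w
    tail true  eq rewrite eq = trans (f-tail e) (cong (if_then w else v) eq)
    tail false eq rewrite eq = trans (f-head e) (cong (if_then v else w) eq)
  ... | no _ | yes (u , e) = head (T′.adj u w) refl
    where
    head : ∀ b → T′.adj u w ≡ b → f (if T′.adj u w then w else u) ≡ w
    head true  eq rewrite eq = trans (f-head e) (cong (if_then w else u) eq)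
    head false eq rewrite eq = trans (f-tail e) (cong (if_then u else w) eq)
  ... | no ¬out | no ¬in = f-isolated ¬out ¬in

  preserves : ∀ {u v} → u H.⟶ v → f u T′.⟶ f v
  preserves {u} {v} e with T′.total u≢v
    where
    u≢v : u ≢ v
    u≢v refl = H.asym e e
  ... | inj₁ uv = subst₂ T′._⟶_ (sym (trans (f-tail e) (cong (if_then u else v) on)))
                                (sym (trans (f-head e) (cong (if_then v else u) on))) uv
    where
    on : T′.adj u v ≡ true
    on = T-ext _ (λ _ → uv)
  ... | inj₂ vu = subst₂ T′._⟶_ (sym (trans (f-tail e) (cong (if_then u else v) off)))
                                (sym (trans (f-head e) (cong (if_then v else u) off))) vu
    where
    off : T′.adj u v ≡ false
    off = T-ext (T′.asym vu) λ ()

  copy : Copy H T′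
  copy = f , (λ {u} {v} eq → trans (sym (f-involutive u)) (trans (cong f eq) (f-involutive v))) , preserves

-- Decidability of unavoidability and existence of the Ramsey number.

module _ (H : Digraph n) (N : ℕ) where
  private module H = Digraph H

  IsTournament : (Fin N → Fin N → Bool) → Set
  IsTournament a = (∀ u v → T (a u v) → ¬ T (a v u)) × (∀ u v → u ≢ v → T (a u v) ⊎ T (a v u))

  IsTournament? : (a : Fin N → Fin N → Bool) → Dec (IsTournament a)
  IsTournament? a =
    (Fin.all? λ u → Fin.all? λ v → T? (a u v) →-dec ¬? (T? (a v u))) ×-dec
    (Fin.all? λ u → Fin.all? λ v → ¬? (u Fin.≟ v) →-dec (T? (a u v) ⊎-dec T? (a v u)))

  Embeds : (Fin N → Fin N → Bool) → (Fin n → Fin N) → Set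
  Embeds a f = (∀ u v → f u ≡ f v → u ≡ v) × (∀ u v → u H.⟶ v → T (a (f u) (f v)))

  Embeds? : (a : Fin N → Fin N → Bool) (f : Fin n → Fin N) → Dec (Embeds a f)
  Embeds? a f =
    (Fin.all? λ u → Fin.all? λ v → (f u Fin.≟ f v) →-dec (u Fin.≟ v)) ×-dec
    (Fin.all? λ u → Fin.all? λ v → T? (H.adj u v) →-dec T? (a (f u) (f v)))

  -- Adjacency matrices and maps are enumerated through Subset (N * N) and
  -- Fin (N ^ n), so that no function extensionality is needed.
  decode : Subset (N * N) → Fin N → Fin N → Bool
  decode s u v = lookup s (combine u v)

  encode : (Fin N → Fin N → Bool) → Subset (N * N)
  encode a = tabulate λ i → a (proj₁ (remQuot {N} N i)) (proj₂ (remQuot {N} N i))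

  decode-encode : (a : Fin N → Fin N → Bool) → ∀ u v → decode (encode a) u v ≡ a u v
  decode-encode a u v = trans (lookup∘tabulate _ (combine u v))
    (cong (λ p → a (proj₁ p) (proj₂ p)) (Fin.remQuot-combine {N} {N} u v))

  Counterexample : Subset (N * N) → Set
  Counterexample s = IsTournament (decode s) × ¬ (∃[ c ] Embeds (decode s) (finToFun {N} {n} c))

  Counterexample? : (s : Subset (N * N)) → Dec (Counterexample s)
  Counterexample? s = IsTournament? (decode s) ×-dec ¬? (Fin.any? λ c → Embeds? (decode s) (finToFun c))

  unavoidable? : Dec (Unavoidable H N)
  unavoidable? with anySubset? {P = Counterexample} Counterexample?
  ... | yes (s , (as , tot) , none) = no λ unavoidable →
    let f , inj , pres = unavoidable (record
          { digraph = record { adj = decode s ; asym = λ {u} {v} → as u v }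
          ; total = λ {u} {v} → tot u v })
        same = Fin.finToFun-funToFin f
    in none (funToFin f
        , (λ u v eq → inj (trans (sym (same u)) (trans eq (same v))))
        , (λ u v e → subst₂ (λ x y → T (decode s x y)) (sym (same u)) (sym (same v)) (pres e)))
  -- The absence of a counterexample only refutes the absence of a copy. The codes of maps form a
  -- finite type, so this double negation can be removed.
  ... | no none = yes λ T′ → find T′ (decidable-stable (Fin.any? λ c → Embeds? (decode (encode (Tournament.adj T′))) (finToFun c))
                                 λ ¬copy → none (encode (Tournament.adj T′) , encodes T′ , ¬copy))
    where
    encodes : (T′ : Tournament N) → IsTournament (decode (encode (Tournament.adj T′)))
    encodes T′ = (λ u v e e′ → T′.asym (subst T (code u v) e) (subst T (code v u) e′))
      , (λ u v u≢v → Sum.map (subst T (sym (code u v))) (subst T (sym (code v u))) (T′.total u≢v))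
      where
      module T′ = Tournament T′
      code = decode-encode T′.adj
    find : (T′ : Tournament N) → ∃[ c ] Embeds (decode (encode (Tournament.adj T′))) (finToFun {N} {n} c) → Copy H T′
    find T′ (c , inj , pres) = finToFun c , (λ {u} {v} → inj u v)
      , (λ {u} {v} e → subst T (decode-encode (Tournament.adj T′) _ _) (pres u v e))

-- Upward search, where `gap` is the remaining distance to the known witness and makes the recursion
-- structural.
least-witness : {P : ℕ → Set} → (∀ k → Dec (P k)) → ∀ {u} → P u → ∃[ r ] (P r × (∀ {k} → P k → r ≤ k))
least-witness {P} P? {u} Pu = search 0 u (λ _ ()) (subst P (sym (+-identityʳ u)) Pu)
  where
  search : ∀ lo gap → (∀ k → k < lo → ¬ P k) → P (gap + lo) → ∃[ r ] (P r × (∀ {k} → P k → r ≤ k))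
  search lo gap below top with P? lo
  ... | yes p = lo , p , λ {k} Pk → ≮⇒≥ (λ k<lo → below k k<lo Pk)
  search lo zero below top | no ¬p = contradiction top ¬p
  search lo (suc gap) below top | no ¬p = search (suc lo) gap below′ (subst P (sym (+-suc gap lo)) top)
    where
    below′ : ∀ k → k < suc lo → ¬ P k
    below′ k k<1+lo Pk with k ≟ lo
    ... | yes refl = ¬p Pk
    ... | no k≢lo = below k (≤∧≢⇒< (≤-pred k<1+lo) k≢lo) Pk

ramsey-number : (H : Digraph n) {U : ℕ} → Unavoidable H U → ∃[ r ] (IsRamseyNumber H r × r ≤ U)
ramsey-number H unavoidable =
  let r , Pr , least = least-witness (unavoidable? H) unavoidable
  in r , record { unavoidable = Pr ; least = least } , least unavoidable

-- Degree, height and levels of a graded digraph.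

∣tabulate∣≡# : (S : Sub n) → ∣ tabulate S ∣ ≡ # S
∣tabulate∣≡# {zero}  S = refl
∣tabulate∣≡# {suc n} S with S zero
... | true  = cong suc (∣tabulate∣≡# (S ∘ suc))
... | false = ∣tabulate∣≡# (S ∘ suc)

module _ (H : Digraph n) where
  private module H = Digraph H

  degree≡# : ∀ v → H.degree v ≡ # H.adj v + # (λ u → H.adj u v)
  degree≡# v = cong₂ _+_ (∣tabulate∣≡# (H.adj v)) (∣tabulate∣≡# (λ u → H.adj u v))

  degree≤maxDegree : ∀ {Δ} → maxDegree H ≡ Δ → ∀ v → # H.adj v + # (λ u → H.adj u v) ≤ Δ
  degree≤maxDegree refl v = subst (_≤ maxDegree H) (degree≡# v)
    (All.lookup (xs≤max 0 (map H.degree (allFin n))) (∈-map⁺ H.degree (∈-allFin v)))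

  no-edges⇒maxDegree≤0 : (∀ {u v} → ¬ u H.⟶ v) → maxDegree H ≤ 0
  no-edges⇒maxDegree≤0 no-edge = max≤v⁺ z≤n (All.map⁺ (All.tabulate⁺ {f = id} λ v →
      ≤-reflexive (trans (degree≡# v) (cong₂ _+_ (empty (H.adj v) (λ _ → no-edge)) (empty (λ u → H.adj u v) (λ _ → no-edge))))))
    where
    empty : (S : Sub n) → (∀ i → ¬ T (S i)) → # S ≡ 0
    empty S none = n≤0⇒n≡0 (≮⇒≥ λ 0<#S → let i , Si = #-inhabited S 0<#S in none i Si)

lookup-injective : ∀ {A : Set} {xs : List A} → Unique xs → ∀ {i j} → List.lookup xs i ≡ List.lookup xs j → i ≡ j
lookup-injective (x∉xs ∷ _) {zero}  {zero}  _  = refl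
lookup-injective (x∉xs ∷ _) {zero}  {suc j} eq = contradiction eq (All.lookup x∉xs (∈-lookup j))
lookup-injective (x∉xs ∷ _) {suc i} {zero}  eq = contradiction (sym eq) (All.lookup x∉xs (∈-lookup i))
lookup-injective (_ ∷ u)    {suc i} {suc j} eq = cong suc (lookup-injective u eq)

module _ {H : Digraph n} {h : ℕ} (graded : IsGraded H h) where
  open IsGraded graded
  private module H = Digraph H

  -- The positions on a longest path inject into the vertices.
  height≤order : h ≤ n
  height≤order with (_ , (_ , unique) , refl) , _ ← height = Fin.injective⇒≤ (lookup-injective unique)

  -- With a single level, independence would leave no edge. The strict bound makes the rounded
  -- logarithm of `h` positive.
  1<height : 1 ≤ maxDegree H → 1 < h
  1<height 1≤Δ = ≰⇒> λ h≤1 → contradiction 1≤Δ (≤⇒≯ (no-edges⇒maxDegree≤0 H λ {u} {v} →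
    independent (Fin.toℕ-injective (trans (bottom h≤1 u) (sym (bottom h≤1 v))))))
    where
    bottom : h ≤ 1 → ∀ u → toℕ (level u) ≡ 0
    bottom h≤1 u = n≤0⇒n≡0 (≤-pred (≤-trans (Fin.toℕ<n (level u)) h≤1))

  -- Lexicographic order with the levels reversed, so that the top level is placed first; the second
  -- component separates vertices of one level.
  key : Fin n → Fin (h * n)
  key u = combine (opposite (level u)) u

  key-injective : ∀ {u v} → key u ≡ key v → u ≡ v
  key-injective {u} {v} = Fin.combine-injectiveʳ (opposite (level u)) u (opposite (level v)) v

  key-decreasing : ∀ {u v} → u H.⟶ v → key v Fin.< key u
  key-decreasing {u} {v} e = Fin.combine-monoˡ-< v u
    (subst₂ _<_ (sym (Fin.opposite-prop (level v))) (sym (Fin.opposite-prop (level u)))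
      (∸-monoʳ-< (s≤s (≤-reflexive (sym (consecutive e)))) (Fin.toℕ<n (level v))))

  unavoidable-large : ∀ {Δ} → maxDegree H ≡ Δ → 1 ≤ Δ → ∀ j → h ≤ 2 ^ j →
    Unavoidable H (((8 * Δ) ^ Δ) ^ j * (4 * n))
  unavoidable-large {Δ} Δ≡ 1≤Δ j h≤2^j T′ =
    copy-in-large (toℕ ∘ level) consecutive j (λ u → <-≤-trans (Fin.toℕ<n (level u)) h≤2^j) ≤-refl
    where
    open Embedding H T′ Δ 1≤Δ (≤-trans (<⇒≤ (1<height (subst (1 ≤_) (sym Δ≡) 1≤Δ))) height≤order)
           (degree≤maxDegree H Δ≡) key key-injective key-decreasing

-- Numerical estimates.

^-distribʳ-* : ∀ a b k → (a * b) ^ k ≡ a ^ k * b ^ k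
^-distribʳ-* a b zero    = refl
^-distribʳ-* a b (suc k) = trans (cong (a * b *_) (^-distribʳ-* a b k)) (swap a b (a ^ k) (b ^ k))
  where
  swap : ∀ a b c d → a * b * (c * d) ≡ a * c * (b * d)
  swap = solve-∀

^-comm : ∀ a b c → (a ^ b) ^ c ≡ (a ^ c) ^ b
^-comm a b c = trans (^-*-assoc a b c) (trans (cong (a ^_) (*-comm b c)) (sym (^-*-assoc a c b)))

floor-log₂ : ∀ {m} → 1 ≤ m → ∃[ k ] (2 ^ k ≤ m × m < 2 ^ suc k)
floor-log₂ {suc zero}    _ = 0 , ≤-refl , ≤-refl
floor-log₂ {suc (suc m)} _ with floor-log₂ {suc m} (s≤s z≤n)
... | k , lo , hi with suc (suc m) <? 2 ^ suc k
...   | yes lt = k , m≤n⇒m≤1+n lo , lt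
...   | no ≮ = suc k , ≮⇒≥ ≮ , ≤-<-trans hi (^-monoʳ-< 2 ≤-refl (n<1+n (suc k)))

floor-log₂>0 : ∀ {m} → 2 ≤ m → ∃[ k ] (1 ≤ k × 2 ^ k ≤ m × m < 2 ^ suc k)
floor-log₂>0 2≤m with floor-log₂ (<⇒≤ 2≤m)
... | zero  , _ , m<2 = contradiction 2≤m (<⇒≱ m<2)
... | suc k , bounds  = suc k , s≤s z≤n , bounds

-- `Δ ^ (c * k)` is `2 ^ k` raised to the power `c` times the logarithm of `Δ`, and `2 ^ k ≤ b`. For
-- a rational bound `p / q` on that exponent, the exchange of exponents takes place after raising to
-- the power `q`.
≤^^-log₂ : ∀ {r b m Δ c k} → 2 ^ k ≤ b → r ≤ Δ ^ (c * k) * m → r ≤[ b ^^ c ·log₂ Δ ]* m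
≤^^-log₂ {r} {b} {m} {Δ} {c} {k} 2^k≤b r≤ p q Δ^cq≤2^p = begin
  r ^ q                         ≤⟨ ^-monoˡ-≤ q r≤ ⟩
  (Δ ^ (c * k) * m) ^ q         ≡⟨ ^-distribʳ-* (Δ ^ (c * k)) m q ⟩
  (Δ ^ (c * k)) ^ q * m ^ q     ≡⟨ cong (λ x → x ^ q * m ^ q) (^-*-assoc Δ c k) ⟨
  ((Δ ^ c) ^ k) ^ q * m ^ q     ≡⟨ cong (_* m ^ q) (^-comm (Δ ^ c) k q) ⟩
  ((Δ ^ c) ^ q) ^ k * m ^ q     ≡⟨ cong (λ x → x ^ k * m ^ q) (^-*-assoc Δ c q) ⟩
  (Δ ^ (c * q)) ^ k * m ^ q     ≤⟨ *-monoˡ-≤ (m ^ q) (^-monoˡ-≤ k Δ^cq≤2^p) ⟩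
  (2 ^ p) ^ k * m ^ q           ≡⟨ cong (_* m ^ q) (^-comm 2 p k) ⟩
  (2 ^ k) ^ p * m ^ q           ≤⟨ *-monoˡ-≤ (m ^ q) (^-monoˡ-≤ p 2^k≤b) ⟩
  b ^ p * m ^ q                 ∎
  where open ≤-Reasoning

module _ {Δ} (2≤Δ : 2 ≤ Δ) where
  open ≤-Reasoning
  private
    instance
      Δ≢0 : NonZero Δ
      Δ≢0 = >-nonZero (<-trans (s≤s z≤n) 2≤Δ)

  size-bound : ∀ j → ((8 * Δ) ^ Δ) ^ j * (4 * n) ≤ Δ ^ (4 * Δ * j + 2) * n
  size-bound {n} j = begin
    -- Constants become powers of `Δ`: `8 ≤ Δ ^ 3` and `4 ≤ Δ ^ 2`.
    ((8 * Δ) ^ Δ) ^ j * (4 * n)      ≤⟨ *-mono-≤ (^-monoˡ-≤ j (^-monoˡ-≤ Δ 8Δ≤Δ⁴)) (*-monoˡ-≤ n (^-monoˡ-≤ 2 2≤Δ)) ⟩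
    ((Δ ^ 4) ^ Δ) ^ j * (Δ ^ 2 * n)  ≡⟨ cong (λ x → x ^ j * (Δ ^ 2 * n)) (^-*-assoc Δ 4 Δ) ⟩
    (Δ ^ (4 * Δ)) ^ j * (Δ ^ 2 * n)  ≡⟨ cong (_* (Δ ^ 2 * n)) (^-*-assoc Δ (4 * Δ) j) ⟩
    Δ ^ (4 * Δ * j) * (Δ ^ 2 * n)    ≡⟨ *-assoc (Δ ^ (4 * Δ * j)) (Δ ^ 2) n ⟨
    Δ ^ (4 * Δ * j) * Δ ^ 2 * n      ≡⟨ cong (_* n) (^-distribˡ-+-* Δ (4 * Δ * j) 2) ⟨
    Δ ^ (4 * Δ * j + 2) * n          ∎
    where
    8Δ≤Δ⁴ : 8 * Δ ≤ Δ ^ 4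
    8Δ≤Δ⁴ = ≤-trans (≤-reflexive (*-comm 8 Δ)) (*-monoʳ-≤ Δ (^-monoˡ-≤ 3 2≤Δ))

  -- The source of the constant 10. The three terms pay for `suc k` doublings, for the factor 4, and
  -- for replacing `n` by a power of `Δ` in `size≤-order`. By `2 ≤ Δ` and `suc k ≤ Δ * k` the sum is
  -- at most `5 * Δ * k + 5 * Δ`. Equality holds at `Δ = 2`, `k = 1`.
  exponent-bound : ∀ {k} → 1 ≤ k → 4 * Δ * suc k + 2 + suc k ≤ 10 * Δ * k
  exponent-bound {suc k} _ = begin
    4 * Δ * suc (suc k) + 2 + suc (suc k)                    ≤⟨ +-monoˡ-≤ (suc (suc k)) (+-monoʳ-≤ (4 * Δ * suc (suc k)) 2≤Δ) ⟩
    4 * Δ * suc (suc k) + Δ + suc (suc k)                    ≤⟨ +-monoʳ-≤ (4 * Δ * suc (suc k) + Δ) le ⟩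
    4 * Δ * suc (suc k) + Δ + Δ * suc k                      ≤⟨ m≤m+n _ (5 * (Δ * k)) ⟩
    4 * Δ * suc (suc k) + Δ + Δ * suc k + 5 * (Δ * k)        ≡⟨ collect Δ k ⟩
    10 * Δ * suc k                                           ∎
    where
    le : suc (suc k) ≤ Δ * suc k
    le = begin
      suc (suc k)   ≤⟨ s≤s (m≤n+m (suc k) k) ⟩
      suc k + suc k ≡⟨ cong (suc k +_) (+-identityʳ (suc k)) ⟨
      2 * suc k     ≤⟨ *-monoˡ-≤ (suc k) 2≤Δ ⟩
      Δ * suc k     ∎
    collect : ∀ d k → 4 * d * suc (suc k) + d + d * suc k + 5 * (d * k) ≡ 10 * d * suc k
    collect = solve-∀

  size≤-height : ∀ {k} → 1 ≤ k → ((8 * Δ) ^ Δ) ^ suc k * (4 * n) ≤ Δ ^ (10 * Δ * k) * n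
  size≤-height {n} {k} 1≤k = ≤-trans (size-bound (suc k))
    (*-monoˡ-≤ n (^-monoʳ-≤ Δ (≤-trans (m≤m+n _ (suc k)) (exponent-bound 1≤k))))

  size≤-order : ∀ {k} → 1 ≤ k → n ≤ 2 ^ suc k → ((8 * Δ) ^ Δ) ^ suc k * (4 * n) ≤ Δ ^ (10 * Δ * k) * 1
  size≤-order {n} {k} 1≤k n≤ = begin
    ((8 * Δ) ^ Δ) ^ suc k * (4 * n)            ≤⟨ size-bound (suc k) ⟩
    Δ ^ (4 * Δ * suc k + 2) * n                ≤⟨ *-monoʳ-≤ (Δ ^ (4 * Δ * suc k + 2)) (≤-trans n≤ (^-monoˡ-≤ (suc k) 2≤Δ)) ⟩
    Δ ^ (4 * Δ * suc k + 2) * Δ ^ suc k        ≡⟨ ^-distribˡ-+-* Δ (4 * Δ * suc k + 2) (suc k) ⟨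
    Δ ^ (4 * Δ * suc k + 2 + suc k)            ≤⟨ ^-monoʳ-≤ Δ (exponent-bound 1≤k) ⟩
    Δ ^ (10 * Δ * k)                           ≡⟨ *-identityʳ _ ⟨
    Δ ^ (10 * Δ * k) * 1                       ∎

-- The bounds in terms of height and order.

ramsey-number≤order : (H : Digraph n) → maxDegree H ≡ 1 → ∃[ r ] (IsRamseyNumber H r × r ≤ n)
ramsey-number≤order H Δ≡1 = ramsey-number H λ T′ → Matching.copy H T′ (degree≤maxDegree H Δ≡1)

module _ (H : Digraph n) (h Δ : ℕ) (graded : IsGraded H h) (Δ≡ : maxDegree H ≡ Δ) (2≤Δ : 2 ≤ Δ) where
  private
    1≤Δ : 1 ≤ Δ
    1≤Δ = <⇒≤ 2≤Δ

    1<h : 1 < h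
    1<h = 1<height graded (subst (1 ≤_) (sym Δ≡) 1≤Δ)

  -- The chain has `2 ^ suc k` sets, enough for `h` levels, while the bound only has `2 ^ k ≤ h` at
  -- its disposal; `exponent-bound` covers the rounding.
  ramsey-bound-by-height : ∃[ r ] (IsRamseyNumber H r × r ≤[ h ^^ (10 * Δ) ·log₂ Δ ]* n)
  ramsey-bound-by-height with k , 1≤k , 2^k≤h , h<2^1+k ← floor-log₂>0 1<h =
    let r , isRamsey , r≤ = ramsey-number H (unavoidable-large graded Δ≡ 1≤Δ (suc k) (<⇒≤ h<2^1+k))
    in r , isRamsey , ≤^^-log₂ {c = 10 * Δ} {k} 2^k≤h (≤-trans r≤ (size≤-height 2≤Δ 1≤k))

  ramsey-bound-by-order : ∃[ r ] (IsRamseyNumber H r × r ≤[ n ^^ (10 * Δ) ·log₂ Δ ]* 1)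
  -- Here `k` comes from `n` instead of `h`, so that `2 ^ suc k` exceeds `n` too and the factor `n`
  -- goes into the exponent.
  ramsey-bound-by-order with k , 1≤k , 2^k≤n , n<2^1+k ← floor-log₂>0 (≤-trans 1<h (height≤order graded)) =
    let r , isRamsey , r≤ = ramsey-number H (unavoidable-large graded Δ≡ 1≤Δ (suc k)
                              (≤-trans (height≤order graded) (<⇒≤ n<2^1+k)))
    in r , isRamsey , ≤^^-log₂ {c = 10 * Δ} {k} 2^k≤n (≤-trans r≤ (size≤-order 2≤Δ 1≤k (<⇒≤ n<2^1+k)))

theorem1p5 : (∀ {n} (H : Digraph n) (h Δ : ℕ) →
    IsGraded H h → maxDegree H ≡ Δ → 1 ≤ Δ →
    ∃[ r ] (IsRamseyNumber H r × r ≤[ h ^^ (10 * Δ) ·log₂ Δ ]* n))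
    ×
    (∃[ C ] (∀ {n} (H : Digraph n) (h Δ : ℕ) →
    IsGraded H h → maxDegree H ≡ Δ → 2 ≤ Δ →
    ∃[ r ] (IsRamseyNumber H r × r ≤[ n ^^ (C * Δ) ·log₂ Δ ]* 1)))
theorem1p5 = by-height , 10 , ramsey-bound-by-order
  where
  by-height : ∀ {n} (H : Digraph n) (h Δ : ℕ) → IsGraded H h → maxDegree H ≡ Δ → 1 ≤ Δ →
    ∃[ r ] (IsRamseyNumber H r × r ≤[ h ^^ (10 * Δ) ·log₂ Δ ]* n)
  by-height {n} H h Δ graded Δ≡ 1≤Δ with m≤n⇒m<n∨m≡n 1≤Δ
  ... | inj₁ 2≤Δ = ramsey-bound-by-height H h Δ graded Δ≡ 2≤Δ
  -- The logarithm of 1 is zero and every `p` is admissible, in particular 0, so the claim amounts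
  -- to `r ≤ n`.
  ... | inj₂ refl =
    let r , isRamsey , r≤n = ramsey-number≤order H Δ≡
    in r , isRamsey , λ p q _ → ≤-trans (^-monoˡ-≤ q r≤n) (m≤n*m (n ^ q) (h ^ p) {{m^n≢0 h p {{h≢0}}}})
    where
    h≢0 : NonZero h
    h≢0 = >-nonZero (<⇒≤ (1<height graded (subst (1 ≤_) (sym Δ≡) 1≤Δ)))
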